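{- Let $G$ be a graph and let $\Sigma$ be a discrete, crossing-finite, ECC separation system of $G$. Let $M_\Sigma$ be the median graph dual to $\Sigma$, and define $\beta:V(M_\Sigma)\to\mathcal P(V(G))$ by $$\beta(\mathcal U)=\bigcap_{(A,B)\in\mathcal U}A.$$ Then $(M_\Sigma,\beta)$ is a median decomposition of $G$.
   Context: Graphs are simple, undirected, possibly infinite. A separation of $G$ is an ordered pair $(A,B)$ of subsets of $V(G)$ with $A\cup B=V(G)$ and no edge joining $A\setminus B$ to $B\setminus A$. It is essential if $A\ne V(G)\neq B$. Its flip is $(A,B)^r=(B,A)$. Order: $(A,B)\le(C,D)$ iff $A\subseteq C$ and $D\subseteq B$. Two separations are nested if $(A,B)$ is comparable with $(C,D)$ or $(D,C)$; otherwise they cross. A separation system is a set $\Sigma$ of essential separations closed under flips. $\Sigma$ is discrete if $\{t\in\Sigma: s_1\le t\le s_2\}$ is finite for all $s_1,s_2\in\Sigma$; crossing-finite if every set of pairwise-crossing elements is finite; ECC if for every infinite strictly descending chain $(A_1,B_1)>(A_2,B_2)>\cdots$ in $\Sigma$, $\bigcap_n(A_n\setminus B_n)=\emptyset$. An ultrafilter on $\Sigma$ is a subset $\mathcal U\subseteq\Sigma$ such that for each $s\in\Sigma$ exactly one of $s,s^r$ lies in $\mathcal U$, and $s\in\mathcal U$, $s\le t\in\Sigma$ imply $t\in\mathcal U$. It is DCC if every descending chain in $\mathcal U$ is finite. The dual median graph $M_\Sigma$ has as vertices the DCC ultrafilters on $\Sigma$, with $\mathcal U,\mathcal V$ adjacent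 iff $|\mathcal U\triangle\mathcal V|=2$. The empty intersection is interpreted as $V(G)$. $I(u,v)$ is the set of vertices on some geodesic (shortest path) from $u$ to $v$. A median graph is a connected graph in which $I(u,v)\cap I(v,w)\cap I(w,u)$ is a single vertex for all vertices $u,v,w$. A subgraph $C$ is convex if every geodesic with endpoints in $C$ is contained in $C$. A median decomposition of $G$ is a pair $(M,\beta)$ with $M$ a median graph and $\beta:V(M)\to\mathcal P(V(G))$ such that (M1) $\bigcup_u\beta(u)=V(G)$; (M2) every edge of $G$ has both ends in some $\beta(u)$; (M3) for every $v\in V(G)$ the set $\beta^{ -1}(v)=\{u: v\in\beta(u)\}$ induces a convex subgraph of $M$. -}

module Defs where

open import Level using (Level; _⊔_; suc)
open import Data.Nat.Base as ℕ using (ℕ)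
open import Data.List.Base as List using (List)
import Data.List.Membership.Setoid as Membership
import Data.List.Relation.Unary.Any as Any
open import Data.List.Relation.Unary.All using (All)
import Data.List.Relation.Unary.Unique.Setoid as UniqueSetoid
open import Data.Product.Base using (Σ; Σ-syntax; ∃-syntax; _×_; _,_; proj₁; proj₂; swap)
open import Data.Product using (∃!)
open import Data.Sum.Base as Sum using (_⊎_)
open import Function.Bundles using (_⇔_; mk⇔; Equivalence)
open import Relation.Binary.Bundles using (Setoid)
open import Relation.Binary.Core using (Rel)
open import Relation.Binary.Definitions using (Symmetric; Irreflexive; _Respects_; _Respects₂_)
open import Relation.Binary.PropositionalEquality.Core using (_≡_; refl)
open import Relation.Binary.Structures using (IsEquivalence)
open import Relation.Nullary.Negation.Core using (¬_)
open import Relation.Unary using (Pred; Empty; Universal; _∈_; _∉_; _⊆_; _≐_; _∩_; _∪_; _∖_; ⋂)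

private variable
  ℓ m c p : Level

-- Subsets are predicates; since separations and ultrafilters are built from
-- subsets, equality on them is extensional and all carriers are setoids.

module Cardinality (S : Setoid c ℓ) where
  open Setoid S using () renaming (Carrier to X)
  open Membership S using () renaming (_∈_ to _∈ₗ_)
  open UniqueSetoid S using (Unique)

  HasSize : Pred X p → ℕ → Set _
  HasSize P n = Σ[ xs ∈ List X ]
    (Unique xs × List.length xs ≡ n × (∀ x → x ∈ P ⇔ x ∈ₗ xs))

  Finite : Pred X p → Set _
  Finite P = ∃[ n ] HasSize P n

record Graph ℓ : Set (suc ℓ) where
  field
    vertexSetoid : Setoid ℓ ℓ
  open Setoid vertexSetoid public using (_≈_) renaming (Carrier to V)
  field
    Adj        : Rel V ℓ
    adj-resp   : Adj Respects₂ _≈_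
    adj-sym    : Symmetric Adj
    adj-irrefl : Irreflexive _≈_ Adj

module GraphNotions (G : Graph ℓ) where
  open Graph G
  open Membership vertexSetoid using () renaming (_∈_ to _∈ₗ_)
  open UniqueSetoid vertexSetoid using (Unique)

  data Walk : V → V → Set ℓ where
    [_] : ∀ {u v} → u ≈ v → Walk u v
    _∷_ : ∀ {u v w} → Adj u v → Walk v w → Walk u w

  vertices : ∀ {u v} → Walk u v → List V
  vertices {u} [ _ ]   = List.[ u ]
  vertices {u} (_ ∷ w) = u List.∷ vertices w

  Path : V → V → Set ℓ
  Path u v = Σ[ w ∈ Walk u v ] Unique (vertices w)

  pathVertices : ∀ {u v} → Path u v → List V
  pathVertices (w , _) = vertices w

  walkLength : ∀ {u v} → Walk u v → ℕ
  walkLength [ _ ]   = 0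
  walkLength (_ ∷ w) = ℕ.suc (walkLength w)

  length : ∀ {u v} → Path u v → ℕ
  length (w , _) = walkLength w

  IsGeodesic : ∀ {u v} → Path u v → Set ℓ
  IsGeodesic {u} {v} P = (Q : Path u v) → length P ℕ.≤ length Q

  I : V → V → Pred V ℓ
  I u v x = Σ[ P ∈ Path u v ] (IsGeodesic P × x ∈ₗ pathVertices P)

  Connected : Set ℓ
  Connected = V × (∀ u v → Path u v)

  IsMedian : Set ℓ
  IsMedian = Connected
    × (∀ u v w → ∃! _≈_ (_∈ (I u v ∩ I v w ∩ I w u)))

  -- Convexity of the subgraph induced by C: an induced subgraph contains a
  -- path as soon as it contains the vertices of the path.
  IsConvex : Pred V p → Set (ℓ ⊔ p)
  IsConvex C = ∀ {u v} → u ∈ C → v ∈ C →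
    (P : Path u v) → IsGeodesic P → All C (pathVertices P)

record IsMedianDecomposition (G : Graph ℓ) (M : Graph m)
         (β : Graph.V M → Pred (Graph.V G) p) : Set (ℓ ⊔ m ⊔ p) where
  private
    module G = Graph G
    module M = Graph M
  open GraphNotions M using (IsMedian; IsConvex)
  field
    β-cong : ∀ {u v} → u M.≈ v → β u ≐ β v
    β-resp : ∀ u → β u Respects G._≈_
    median : IsMedian
    M1     : ∀ v → ∃[ u ] v ∈ β u
    M2     : ∀ {x y} → G.Adj x y → ∃[ u ] (x ∈ β u × y ∈ β u)
    M3     : ∀ v → IsConvex (λ u → v ∈ β u)

module Separations (G : Graph ℓ) where
  open Graph G

  record Separation : Set (suc ℓ) where
    field
      A B    : Pred V ℓ
      A-resp : A Respects _≈_
      B-resp : B Respects _≈_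
      cover  : Universal (A ∪ B)
      noEdge : ∀ {x y} → x ∈ A ∖ B → y ∈ B ∖ A → ¬ Adj x y
  open Separation public

  Essential : Separation → Set ℓ
  Essential s = ¬ Universal (A s) × ¬ Universal (B s)

  infix 8 _ʳ
  _ʳ : Separation → Separation
  s ʳ = record
    { A = B s ; B = A s ; A-resp = B-resp s ; B-resp = A-resp s
    ; cover  = λ v → Sum.swap (cover s v)
    ; noEdge = λ x∈ y∈ xy → noEdge s y∈ x∈ (adj-sym xy)
    }

  infix 4 _≈ₛ_ _≤_ _<_

  _≈ₛ_ : Rel Separation ℓ
  s ≈ₛ t = A s ≐ A t × B s ≐ B t

  _≤_ : Rel Separation ℓ
  s ≤ t = A s ⊆ A t × B t ⊆ B s

  _<_ : Rel Separation ℓ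
  s < t = s ≤ t × ¬ s ≈ₛ t

  ≈ₛ-isEquivalence : IsEquivalence _≈ₛ_
  ≈ₛ-isEquivalence = record
    { refl  = ((λ x → x) , (λ x → x)) , ((λ x → x) , (λ x → x))
    ; sym   = λ (a , b) → swap a , swap b
    ; trans = λ ((a , a′) , (b , b′)) ((c , c′) , (d , d′)) →
        ((λ x → c (a x)) , (λ x → a′ (c′ x))) , ((λ x → d (b x)) , (λ x → b′ (d′ x)))
    }

  separationSetoid : Setoid (suc ℓ) ℓ
  separationSetoid = record { isEquivalence = ≈ₛ-isEquivalence }

  open Cardinality separationSetoid public

  Comparable : Rel Separation ℓ
  Comparable s t = s ≤ t ⊎ t ≤ s

  Nested : Rel Separation ℓ
  Nested s t = Comparable s t ⊎ Comparable s (t ʳ)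

  Cross : Rel Separation ℓ
  Cross s t = ¬ Nested s t

  StrictlyDescending : (ℕ → Separation) → Set ℓ
  StrictlyDescending s = ∀ n → s (ℕ.suc n) < s n

  record SeparationSystem : Set (suc ℓ) where
    field
      member    : Pred Separation ℓ
      resp      : member Respects _≈ₛ_
      essential : ∀ {s} → s ∈ member → Essential s
      flip      : ∀ {s} → s ∈ member → s ʳ ∈ member

  module _ (𝓢 : SeparationSystem) where
    open SeparationSystem 𝓢

    Discrete : Set (suc ℓ)
    Discrete = ∀ {s₁ s₂} → s₁ ∈ member → s₂ ∈ member →
      Finite (λ t → t ∈ member × s₁ ≤ t × t ≤ s₂)

    CrossingFinite : Set (suc ℓ)
    CrossingFinite = (X : Pred Separation ℓ) → X Respects _≈ₛ_ → X ⊆ member →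
      (∀ {s t} → s ∈ X → t ∈ X → ¬ s ≈ₛ t → Cross s t) → Finite X

    ECC : Set (suc ℓ)
    ECC = (s : ℕ → Separation) → (∀ n → s n ∈ member) → StrictlyDescending s →
      Empty (⋂ ℕ (λ n → A (s n) ∖ B (s n)))

    record DCCUltrafilter : Set (suc ℓ) where
      field
        𝓤      : Pred Separation ℓ
        𝓤-resp : 𝓤 Respects _≈ₛ_
        𝓤⊆     : 𝓤 ⊆ member
        choose : ∀ {s} → s ∈ member →
                 (s ∈ 𝓤 × s ʳ ∉ 𝓤) ⊎ (s ∉ 𝓤 × s ʳ ∈ 𝓤)
        up     : ∀ {s t} → s ∈ 𝓤 → t ∈ member → s ≤ t → t ∈ 𝓤
        dcc    : ¬ (Σ[ s ∈ (ℕ → Separation) ]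
                     ((∀ n → s n ∈ 𝓤) × StrictlyDescending s))
    open DCCUltrafilter public

    infix 4 _≈ᵤ_

    _≈ᵤ_ : Rel DCCUltrafilter (suc ℓ)
    U ≈ᵤ W = 𝓤 U ≐ 𝓤 W

    ultrafilterSetoid : Setoid (suc ℓ) (suc ℓ)
    ultrafilterSetoid = record
      { _≈_ = _≈ᵤ_
      ; isEquivalence = record
        { refl  = (λ x → x) , (λ x → x)
        ; sym   = swap
        ; trans = λ (a , a′) (b , b′) → (λ x → b (a x)) , (λ x → a′ (b′ x))
        }
      }

    _△_ : Pred Separation ℓ → Pred Separation ℓ → Pred Separation ℓ
    P △ Q = (P ∖ Q) ∪ (Q ∖ P)

    DualAdj : Rel DCCUltrafilter (suc ℓ)
    DualAdj U W = HasSize (𝓤 U △ 𝓤 W) 2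

    private
      △-mono : ∀ {P P′ Q Q′} → P ≐ P′ → Q ≐ Q′ → P △ Q ⊆ P′ △ Q′
      △-mono (p , p′) (q , q′) =
        Sum.map (λ (x , y) → p x , λ z → y (q′ z))
                (λ (x , y) → q x , λ z → y (p′ z))

      HasSize-≐ : ∀ {P Q : Pred Separation ℓ} {n} →
                  P ⊆ Q → Q ⊆ P → HasSize P n → HasSize Q n
      HasSize-≐ f g (xs , uniq , len , mem) = xs , uniq , len , λ x →
        mk⇔ (λ q → Equivalence.to (mem x) (g q))
            (λ i → f (Equivalence.from (mem x) i))

      DualAdj-≈ : ∀ {U U′ W W′} → U ≈ᵤ U′ → W ≈ᵤ W′ → DualAdj U W → DualAdj U′ W′
      DualAdj-≈ {U} {U′} {W} {W′} e f = HasSize-≐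
        (△-mono {𝓤 U} {𝓤 U′} {𝓤 W} {𝓤 W′} e f)
        (△-mono {𝓤 U′} {𝓤 U} {𝓤 W′} {𝓤 W} (swap e) (swap f))

      DualAdj-irrefl : Irreflexive _≈ᵤ_ DualAdj
      DualAdj-irrefl (e , e′) (x List.∷ _ , _ , _ , mem)
        with Equivalence.from (mem x) (Any.here (IsEquivalence.refl ≈ₛ-isEquivalence {x}))
      ... | Sum.inj₁ (u , ¬w) = ¬w (e u)
      ... | Sum.inj₂ (w , ¬u) = ¬u (e′ w)

    dualMedianGraph : Graph (suc ℓ)
    dualMedianGraph = record
      { vertexSetoid = ultrafilterSetoid
      ; Adj        = DualAdj
      ; adj-resp   = (λ {U} {W} {W′} e → DualAdj-≈ {U} {U} {W} {W′} ((λ x → x) , (λ x → x)) e)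
                   , (λ {W} {U} {U′} e → DualAdj-≈ {U} {U′} {W} {W} e ((λ x → x) , (λ x → x)))
      ; adj-sym    = HasSize-≐ Sum.swap Sum.swap
      ; adj-irrefl = λ {U} {W} → DualAdj-irrefl {U} {W}
      }

    β : DCCUltrafilter → Pred V (suc ℓ)
    β U v = ∀ s → s ∈ 𝓤 U → v ∈ A s

{-# OPTIONS --safe #-}

-- For DCC ultrafilters U and W the set U ∖ W is finite: nested elements of it are
-- comparable, so antichains are finite by crossing-finiteness, while U and W forbid
-- infinite chains.  Replacing a minimal element of U by its flip gives a neighbour of U,
-- and doing so along U ∖ W yields a path that crosses each element of U ∖ W once; every
-- walk from U to W must cross all of them.  Hence the geodesics from U to W are the
-- shortest such walks, I U W consists of the ultrafilters containing U ∩ W, and medians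
-- are majority votes.  Convexity of β⁻¹(v) is then immediate.
--
-- For M1 and M2, let K be a vertex or the two ends of an edge.  The separations with
-- K ⊆ A and K ⊈ B are forced, and have the DCC by ECC; those with K ⊆ A ∩ B are oriented
-- around a maximal set of pairwise crossing ones, and have the DCC by discreteness.
-- Since Dec P carries a witness, excluded middle also supplies all the choices needed.
module Submission where

open import Defs
open import Level using (Level; suc; Lift; lift; lower)
open import Axiom.ExcludedMiddle using (ExcludedMiddle)
open Separations using (SeparationSystem; Discrete; CrossingFinite; ECC; dualMedianGraph; β)
open import Data.Empty using (⊥)
open import Data.List.Base as List using (List; []; _∷_; filter; applyUpTo; concatMap)
open import Data.List.Membership.Propositional using (find)
open import Data.List.Properties using (filter-notAll; length-applyUpTo)
open import Data.List.Relation.Unary.All as All using (All; []; _∷_)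
open import Data.List.Relation.Unary.All.Properties using (¬All⇒Any¬)
open import Data.List.Relation.Unary.AllPairs as AllPairs using (AllPairs; []; _∷_)
open import Data.List.Relation.Unary.Any as Any using (Any; here; there)
import Data.List.Relation.Unary.Any.Properties as Anyₚ
import Data.List.Membership.Setoid as Membership
import Data.List.Membership.Setoid.Properties as Membershipₚ
import Data.List.Relation.Unary.Unique.Setoid as UniqueSetoid
import Data.List.Relation.Unary.Unique.Setoid.Properties as Uniqueₚ
open import Data.Nat.Base as ℕ using (ℕ; zero; z≤n)
open import Data.Nat.GeneralisedArithmetic using (fold)
import Data.Nat.Properties as ℕₚ
open import Data.Product.Base using (∃; ∃-syntax; _×_; _,_; proj₁; proj₂; swap)
open import Data.Sum.Base as Sum using (_⊎_; inj₁; inj₂)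
open import Function.Base using (id; _∘_)
open import Function.Bundles using (mk⇔; Equivalence)
open import Relation.Binary.Bundles using (Setoid)
open import Relation.Binary.PropositionalEquality using (_≡_; refl; cong; subst; sym)
open import Relation.Nullary.Decidable using (Dec; yes; no; True; toWitness; fromWitness;
  decidable-stable; toSum)
open import Relation.Nullary.Negation using (¬_; contradiction)
open import Relation.Unary using (Pred; _∈_; _∉_; _⊆_; _≐_; _∪_)

-- Excluded middle at two universe levels.

module Classical {ℓ : Level} (em : ExcludedMiddle (suc ℓ)) where

  em↓ : ExcludedMiddle ℓ
  em↓ {P} with em {Lift (suc ℓ) P}
  ... | yes (lift p) = yes p
  ... | no ¬p        = no (¬p ∘ lift)

  ¬¬-elim : {P : Set (suc ℓ)} → ¬ ¬ P → P
  ¬¬-elim = decidable-stable em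

  -- The ultrafilters and the sets in crossing-finiteness live in Pred Separation ℓ,
  -- whereas quantifying over separations lands in Set (suc ℓ).
  ⌜_⌝ : Set (suc ℓ) → Set ℓ
  ⌜ P ⌝ = Lift ℓ (True (em {P}))

  ⌜⌝-in : {P : Set (suc ℓ)} → P → ⌜ P ⌝
  ⌜⌝-in = lift ∘ fromWitness

  ⌜⌝-out : {P : Set (suc ℓ)} → ⌜ P ⌝ → P
  ⌜⌝-out = toWitness ∘ lower

-- Pigeonhole for antitone predicates on the natural numbers.

Antitone : ∀ {p} → (ℕ → Set p) → Set p
Antitone P = ∀ n → P (ℕ.suc n) → P n

antitone-+ : ∀ {p} {P : ℕ → Set p} → Antitone P → ∀ k n → P (k ℕ.+ n) → P n
antitone-+ anti zero      n p = p
antitone-+ anti (ℕ.suc k) n p = antitone-+ anti k n (anti _ p)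

module _ {p} (em : ExcludedMiddle p) where

  -- If `P` fails at `m`, it fails from `m` on, so `Q` holds there and, being antitone, everywhere.
  -- Along a descending chain this selects one of two up-closed sets that together contain all its
  -- terms.
  split : ∀ {q} {P : ℕ → Set p} {Q : ℕ → Set q} → Antitone P → Antitone Q →
    (∀ n → P n ⊎ Q n) → (∀ n → P n) ⊎ (∀ n → Q n)
  split {P = P} {Q} antiP antiQ pq with em {∃ λ n → ¬ P n}
  ... | no  ∄¬P       = inj₁ λ n → decidable-stable em λ ¬p → ∄¬P (n , ¬p)
  ... | yes (m , ¬Pm) = inj₂ λ n → eventually n (pq (n ℕ.+ m))
    where
    eventually : ∀ n → P (n ℕ.+ m) ⊎ Q (n ℕ.+ m) → Q n
    eventually n (inj₁ p) = contradiction (antitone-+ antiP n m p) ¬Pm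
    eventually n (inj₂ q) = antitone-+ antiQ m n (subst Q (ℕₚ.+-comm n m) q)

  splitAny : ∀ {a} {X : Set a} {P : X → ℕ → Set p} → (∀ x → Antitone (P x)) →
    ∀ xs → (∀ n → Any (λ x → P x n) xs) → Any (λ x → ∀ n → P x n) xs
  splitAny anti []       any with () ← any 0
  splitAny anti (x ∷ xs) any
    with split (anti x) (λ n → Any.map (anti _ n)) (Any.toSum ∘ any)
  ... | inj₁ all  = here all
  ... | inj₂ any′ = there (splitAny anti xs any′)

-- Counting in lists up to setoid equality.

module FiniteSubsets {c ℓ} (S : Setoid c ℓ) (em : ExcludedMiddle ℓ) where
  open Setoid S renaming (refl to ≈-refl; sym to ≈-sym; trans to ≈-trans)
  open Membership S using () renaming (_∈_ to _∈ₗ_)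
  open UniqueSetoid S using (Unique)

  remove : Carrier → List Carrier → List Carrier
  remove x = filter (λ y → em {¬ x ≈ y})

  length-remove : ∀ x ys → x ∈ₗ ys → List.length (remove x ys) ℕ.< List.length ys
  length-remove _ ys = filter-notAll _ ys ∘ Any.map (λ e ¬e → ¬e e)

  ∈-remove : ∀ x y ys → y ∈ₗ ys → ¬ x ≈ y → y ∈ₗ remove x ys
  ∈-remove x y ys = Membershipₚ.∈-filter⁺ S (λ y → em {¬ x ≈ y}) (λ e ¬e x≈y → ¬e (≈-trans x≈y (≈-sym e)))

  -- Each `x` uses up at least one entry of `ys`, since `remove` drops every entry equal to it.
  Unique-length-≤ : ∀ {xs ys} → Unique xs → (∀ x → x ∈ₗ xs → x ∈ₗ ys) →
    List.length xs ℕ.≤ List.length ys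
  Unique-length-≤ []               sub = z≤n
  Unique-length-≤ {x ∷ xs} {ys} (x∉xs ∷ uniq) sub = ℕₚ.≤-<-trans
    (Unique-length-≤ uniq λ y y∈xs → ∈-remove x y ys (sub y (there y∈xs))
      (All.lookupₛ S (λ y≈z x≉y x≈z → x≉y (≈-trans x≈z (≈-sym y≈z))) x∉xs y∈xs))
    (length-remove x ys (sub x (here ≈-refl)))

module Dual {ℓ : Level} (em : ExcludedMiddle (suc ℓ))
  (G : Graph ℓ) (𝓢 : SeparationSystem G)
  (discrete : Discrete G 𝓢) (crossingFinite : CrossingFinite G 𝓢) (ecc : ECC G 𝓢) where

  open Classical em
  open Graph G using (V; Adj)
  open Separations G hiding
    ( SeparationSystem; Discrete; CrossingFinite; ECC; dualMedianGraph; β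
    ; DCCUltrafilter; 𝓤; 𝓤-resp; 𝓤⊆; choose; up; dcc; _△_ )
  open SeparationSystem 𝓢
  DCCUltrafilter = Separations.DCCUltrafilter G 𝓢
  open Separations.DCCUltrafilter {G = G} {𝓢 = 𝓢}
  open Setoid separationSetoid using () renaming (refl to ≈-refl; sym to ≈-sym; trans to ≈-trans)
  open Membership separationSetoid using () renaming (_∈_ to _∈ₗ_)
  open UniqueSetoid separationSetoid using (Unique)
  open FiniteSubsets separationSetoid em↓

  -- Order, flips and crossing of separations.

  ≈⇒≤ : ∀ s t → s ≈ₛ t → s ≤ t
  ≈⇒≤ _ _ ((p , _) , (_ , q)) = p , q

  ≤-antisym : ∀ s t → s ≤ t → t ≤ s → s ≈ₛ t
  ≤-antisym _ _ (p , q) (p′ , q′) = (p , p′) , (q′ , q)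

  ≤-trans : ∀ s t u → s ≤ t → t ≤ u → s ≤ u
  ≤-trans _ _ _ (p , q) (p′ , q′) = (λ x → p′ (p x)) , (λ x → q (q′ x))

  <-≤-trans : ∀ s t u → s < t → t ≤ u → s < u
  <-≤-trans s t u (s≤t , s≉t) t≤u = ≤-trans s t u s≤t t≤u ,
    λ s≈u → s≉t (≤-antisym s t s≤t (≤-trans t u s t≤u (≈⇒≤ u s (≈-sym {s} {u} s≈u))))

  ≤-<-trans : ∀ s t u → s ≤ t → t < u → s < u
  ≤-<-trans s t u s≤t (t≤u , t≉u) = ≤-trans s t u s≤t t≤u ,
    λ s≈u → t≉u (≤-antisym t u t≤u (≤-trans u s t (≈⇒≤ u s (≈-sym {s} {u} s≈u)) s≤t))

  <-flip : ∀ s t → s < t → t ʳ < s ʳ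
  <-flip s t (s≤t , s≉t) = swap s≤t , λ e → s≉t (≈-sym {t} {s} (swap e))

  -- `A s ⊆ B s` would make `B s` everything, against essentiality.
  s≰sʳ : ∀ {s} → s ∈ member → ¬ s ≤ s ʳ
  s≰sʳ {s} s∈ (A⊆B , _) = proj₂ (essential s∈) λ v → Sum.[ A⊆B , id ] (cover s v)

  sʳ≰s : ∀ {s} → s ∈ member → ¬ s ʳ ≤ s
  sʳ≰s {s} s∈ (B⊆A , _) = proj₁ (essential s∈) λ v → Sum.[ id , B⊆A ] (cover s v)

  Nested-sym : ∀ {s t} → Nested s t → Nested t s
  Nested-sym (inj₁ c)        = inj₁ (Sum.swap c)
  Nested-sym (inj₂ (inj₁ p)) = inj₂ (inj₁ (swap p))
  Nested-sym (inj₂ (inj₂ p)) = inj₂ (inj₂ (swap p))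

  Nested-respʳ : ∀ s {t u} → t ≈ₛ u → Nested s t → Nested s u
  Nested-respʳ s {t} {u} e = Sum.map
    (Sum.map (λ p → ≤-trans s t u p (≈⇒≤ t u e)) (≤-trans u t s (≈⇒≤ u t (≈-sym {t} {u} e))))
    (Sum.map (λ p → ≤-trans s (t ʳ) (u ʳ) p (≈⇒≤ (t ʳ) (u ʳ) (swap e)))
             (≤-trans (u ʳ) (t ʳ) s (≈⇒≤ (u ʳ) (t ʳ) (swap (≈-sym {t} {u} e)))))

  Cross-sym : ∀ {s t} → Cross s t → Cross t s
  Cross-sym {s} {t} c = c ∘ Nested-sym {t} {s}

  Cross-respʳ : ∀ s {t u} → t ≈ₛ u → Cross s t → Cross s u
  Cross-respʳ s {t} {u} e c = c ∘ Nested-respʳ s {u} {t} (≈-sym {t} {u} e)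

  Cross-resp : ∀ {s s′ t t′} → s ≈ₛ s′ → t ≈ₛ t′ → Cross s t → Cross s′ t′
  Cross-resp {s} {s′} {t} {t′} e f c = Cross-sym {t′} {s′}
    (Cross-respʳ t′ {s} {s′} e (Cross-sym {s} {t′} (Cross-respʳ s {t} {t′} f c)))

  Cross⇒≉ : ∀ {s t} → Cross s t → ¬ s ≈ₛ t
  Cross⇒≉ {s} {t} c e = c (inj₁ (inj₁ (≈⇒≤ s t e)))

  -- Descending chains and finiteness.

  chain-≤ : ∀ c → StrictlyDescending c → ∀ k n → c (k ℕ.+ n) ≤ c n
  chain-≤ c desc zero      n = id , id
  chain-≤ c desc (ℕ.suc k) n = ≤-trans (c (ℕ.suc k ℕ.+ n)) (c (k ℕ.+ n)) (c n)
    (proj₁ (desc _)) (chain-≤ c desc k n)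

  chain-< : ∀ c → StrictlyDescending c → ∀ {m n} → m ℕ.< n → c n < c m
  chain-< c desc {m} m<n with ℕₚ.m≤n⇒∃[o]m+o≡n m<n
  ... | k , refl = ≤-<-trans (c (ℕ.suc m ℕ.+ k)) (c (ℕ.suc m)) (c m)
    (subst (λ i → c i ≤ c (ℕ.suc m)) (ℕₚ.+-comm k (ℕ.suc m)) (chain-≤ c desc k (ℕ.suc m))) (desc m)

  -- A weak form of finiteness: repetitions and outsiders are harmless in the list, since it only
  -- serves as an upper bound.
  Coverable : ∀ {p} → Pred Separation p → Set _
  Coverable P = ∃[ xs ] (∀ s → s ∈ P → s ∈ₗ xs)

  Finite⇒Coverable : ∀ {p} {P : Pred Separation p} → Finite P → Coverable P
  Finite⇒Coverable (_ , xs , _ , _ , mem) = xs , λ s → Equivalence.to (mem s)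

  ChainFree : ∀ {p} → Pred Separation p → Set _
  ChainFree P = ∀ c → (∀ n → c n ∈ P) → StrictlyDescending c → ⊥

  -- The whole chain lies between `x` and `c 0`, where discreteness allows only finitely many
  -- separations, while the first `length ys + 1` terms are distinct.
  chainFree-above : ∀ {x} → x ∈ member → ChainFree (λ t → t ∈ member × x ≤ t)
  chainFree-above {x} x∈ c c∈ desc
    with ys , cov ← Finite⇒Coverable (discrete x∈ (proj₁ (c∈ 0)))
    = ℕₚ.<-irrefl refl (subst (ℕ._≤ List.length ys) (length-applyUpTo c (ℕ.suc (List.length ys)))
        (Unique-length-≤ distinct listed))
    where
    distinct : Unique (applyUpTo c (ℕ.suc (List.length ys)))
    distinct = Uniqueₚ.applyUpTo⁺₁ separationSetoid c _
      λ {i} {j} i<j _ e → proj₂ (chain-< c desc i<j) (≈-sym {c i} {c j} e)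

    listed : ∀ t → t ∈ₗ applyUpTo c (ℕ.suc (List.length ys)) → t ∈ₗ ys
    listed t t∈ with n , _ , e ← Anyₚ.applyUpTo⁻ c t∈ =
      cov t (resp (≈-sym {t} {c n} e) (proj₁ (c∈ n)) ,
        ≤-trans x (c n) t (proj₂ (c∈ n)) (≈⇒≤ (c n) t (≈-sym {t} {c n} e)) ,
        ≤-trans t (c n) (c 0) (≈⇒≤ t (c n) e)
          (subst (λ i → c i ≤ c 0) (ℕₚ.+-identityʳ n) (chain-≤ c desc n 0)))

  -- Otherwise excluded middle provides the choice function `smaller`, whose iterates form a
  -- forbidden chain.
  minimal : (P : Pred Separation ℓ) → ChainFree P → ∀ {s} → s ∈ P →
    ∃[ m ] (m ∈ P × (∀ t → t ∈ P → ¬ t < m))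
  minimal P free {s} s∈ = ¬¬-elim λ ∄min →
    let
      smaller : (x : ∃ P) → ∃ λ (y : ∃ P) → proj₁ y < proj₁ x
      smaller (x , x∈) = ¬¬-elim λ ∄y → ∄min (x , x∈ , λ t t∈ t<x → ∄y ((t , t∈) , t<x))
      c : ℕ → ∃ P
      c = fold (s , s∈) (proj₁ ∘ smaller)
    in free (proj₁ ∘ c) (proj₂ ∘ c) (λ n → proj₂ (smaller (c n)))

  -- `crossingFinite` wants a predicate of level `ℓ` that respects `≈ₛ`, so `P` is replaced by its
  -- closure under `≈ₛ`, lowered by `⌜_⌝`.
  crossing-coverable : (P : Pred Separation (suc ℓ)) → P ⊆ member →
    (∀ {s t} → s ∈ P → t ∈ P → ¬ s ≈ₛ t → Cross s t) → Coverable P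
  crossing-coverable P P⊆ cross
    with xs , cov ← Finite⇒Coverable (crossingFinite
      (λ t → ⌜ (∃[ s ] (s ∈ P × s ≈ₛ t)) ⌝)
      (λ {t} {u} e t∈ → let s , s∈ , f = ⌜⌝-out t∈ in ⌜⌝-in (s , s∈ , ≈-trans {s} {t} {u} f e))
      (λ t∈ → let s , s∈ , e = ⌜⌝-out t∈ in resp e (P⊆ s∈))
      (λ {t} {t′} t∈ t′∈ t≉t′ →
        let s , s∈ , e = ⌜⌝-out t∈
            s′ , s′∈ , e′ = ⌜⌝-out t′∈
        in Cross-resp {s} {t} {s′} {t′} e e′ (cross s∈ s′∈ λ s≈s′ →
             t≉t′ (≈-trans {t} {s} {t′} (≈-sym {s} {t} e) (≈-trans {s} {s′} {t′} s≈s′ e′)))))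
    = xs , λ s s∈ → cov s (⌜⌝-in (s , s∈ , ≈-refl {s}))

  -- Ultrafilters and the finiteness of their differences.

  excl : ∀ U {s} → s ∈ 𝓤 U → s ʳ ∉ 𝓤 U
  excl U s∈ with choose U (𝓤⊆ U s∈)
  ... | inj₁ (_ , sʳ∉) = sʳ∉
  ... | inj₂ (s∉ , _)  = contradiction s∈ s∉

  flip-∈ : ∀ U {s} → s ∈ member → s ∉ 𝓤 U → s ʳ ∈ 𝓤 U
  flip-∈ U s∈ s∉ with choose U s∈
  ... | inj₁ (s∈U , _) = contradiction s∈U s∉
  ... | inj₂ (_ , sʳ∈) = sʳ∈

  ultrafilter : (P : Pred Separation ℓ) → P ⊆ member →
    (∀ s → s ∈ member → s ∈ P ⊎ s ʳ ∈ P) → (∀ s → s ∈ P → s ʳ ∉ P) →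
    (∀ s t → s ∈ P → t ∈ member → s ≤ t → t ∈ P) → ChainFree P → DCCUltrafilter
  ultrafilter P P⊆ total consistent up free = record
    { 𝓤      = P
    ; 𝓤-resp = λ {s} {t} e s∈ → up s t s∈ (resp e (P⊆ s∈)) (≈⇒≤ s t e)
    ; 𝓤⊆     = P⊆
    ; choose = λ {s} s∈ → Sum.map (λ p → p , consistent s p) (λ p → (λ q → consistent s q p) , p) (total s s∈)
    ; up     = λ {s} {t} → up s t
    ; dcc    = λ (c , c∈ , desc) → free c c∈ desc
    }

  chainFree : ∀ U → ChainFree (𝓤 U)
  chainFree U c c∈ desc = dcc U (c , c∈ , desc)

  _⊖_ : DCCUltrafilter → DCCUltrafilter → Pred Separation ℓ
  (U ⊖ W) s = s ∈ 𝓤 U × s ∉ 𝓤 W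

  ⊖-chainFree : ∀ U W → ChainFree (U ⊖ W)
  ⊖-chainFree U W c c∈ = chainFree U c (proj₁ ∘ c∈)

  -- `s ≤ t ʳ` would put both `t` and `t ʳ` into `U`; `t ʳ ≤ s`, read as `s ʳ ≤ t`, would put `t`
  -- into `W`.
  ⊖-nested⇒comparable : ∀ U W {s t} → s ∈ U ⊖ W → t ∈ U ⊖ W → Nested s t → Comparable s t
  ⊖-nested⇒comparable U W s∈ t∈ (inj₁ c) = c
  ⊖-nested⇒comparable U W {s} {t} (s∈U , _) (t∈U , _) (inj₂ (inj₁ s≤tʳ)) =
    contradiction (up U {s} {t ʳ} s∈U (flip (𝓤⊆ U t∈U)) s≤tʳ) (excl U t∈U)
  ⊖-nested⇒comparable U W {s} {t} (s∈U , s∉W) (t∈U , t∉W) (inj₂ (inj₂ tʳ≤s)) =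
    contradiction (up W {s ʳ} {t} (flip-∈ W (𝓤⊆ U s∈U) s∉W) (𝓤⊆ U t∈U) (swap tʳ≤s)) t∉W

  above : DCCUltrafilter → DCCUltrafilter → Separation → Pred Separation ℓ
  above U W x t = t ∈ U ⊖ W × x < t

  -- The minimal elements of `P` pairwise cross, so a list `ms` covers them, and every other element
  -- of `P` lies above one. Covers of all the upper sets would concatenate to a cover of `P`.
  above-uncoverable : ∀ U W (P : Pred Separation ℓ) → P ⊆ U ⊖ W → ¬ Coverable P →
    ∃[ m ] (m ∈ P × ¬ Coverable (above U W m))
  above-uncoverable U W P P⊆ ¬cov = ¬¬-elim λ ∄m →
    let
      aboveCov : ∀ m → m ∈ P → Coverable (above U W m)
      aboveCov m m∈ = ¬¬-elim λ ¬c → ∄m (m , m∈ , ¬c)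
    in ¬cov (ms List.++ concatMap aboveList ms , covered aboveCov)
    where
    Minimal : Pred Separation (suc ℓ)
    Minimal m = m ∈ P × (∀ t → t ∈ P → ¬ t < m)

    minCov : Coverable Minimal
    minCov = crossing-coverable Minimal (𝓤⊆ U ∘ proj₁ ∘ P⊆ ∘ proj₁)
      λ {s} {t} (s∈ , s-min) (t∈ , t-min) s≉t nested →
        Sum.[ (λ s≤t → t-min s s∈ (s≤t , s≉t)) , (λ t≤s → s-min t t∈ (t≤s , s≉t ∘ ≈-sym {t} {s})) ]
          (⊖-nested⇒comparable U W {s} {t} (P⊆ s∈) (P⊆ t∈) nested)

    ms : List Separation
    ms = proj₁ minCov

    aboveList : Separation → List Separation
    aboveList x with em {Coverable (above U W x)}
    ... | yes (xs , _) = xs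
    -- A default for entries of `ms` without a cover; the argument relies only on entries equal to a
    -- minimal element.
    ... | no  _        = []

    aboveList-covers : ∀ x → Coverable (above U W x) → ∀ t → t ∈ above U W x → t ∈ₗ aboveList x
    aboveList-covers x c with em {Coverable (above U W x)}
    ... | yes (_ , cov) = cov
    ... | no  ¬c        = contradiction c ¬c

    covered : (∀ m → m ∈ P → Coverable (above U W m)) → ∀ s → s ∈ P → s ∈ₗ ms List.++ concatMap aboveList ms
    covered aboveCov s s∈ =
      let
        m , (m∈ , m≤s) , m-min = minimal (λ t → t ∈ P × t ≤ s)
          (λ c c∈ → ⊖-chainFree U W c (P⊆ ∘ proj₁ ∘ c∈)) (s∈ , id , id)
      in viaMin m m∈ m≤s (λ t t∈ t<m → m-min t (t∈ , ≤-trans t m s (proj₁ t<m) m≤s) t<m) em↓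
      where
      viaMin : ∀ m → m ∈ P → m ≤ s → (∀ t → t ∈ P → ¬ t < m) → Dec (m ≈ₛ s) →
        s ∈ₗ ms List.++ concatMap aboveList ms
      viaMin m m∈ m≤s m-min (yes m≈s) = Anyₚ.++⁺ˡ
        (Any.map (λ {x} m≈x → ≈-trans {s} {m} {x} (≈-sym {m} {s} m≈s) m≈x) (proj₂ minCov m (m∈ , m-min)))
      viaMin m m∈ m≤s m-min (no m≉s) = Anyₚ.++⁺ʳ ms (Anyₚ.concatMap⁺ aboveList
        (Any.map (λ {x} m≈x → aboveList-covers x
          (let xs , cov = aboveCov m m∈ in xs , λ t (t∈ , x<t) → cov t (t∈ , ≤-<-trans m x t (≈⇒≤ m x m≈x) x<t))
          s (P⊆ s∈ , ≤-<-trans x m s (≈⇒≤ x m (≈-sym {m} {x} m≈x)) (m≤s , m≉s)))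
          (proj₂ minCov m (m∈ , m-min))))

  -- Otherwise `above-uncoverable` can be iterated to climb forever inside `U ⊖ W`, and the flips of
  -- this ascending sequence descend in `W`.
  ⊖-coverable : ∀ U W → Coverable (U ⊖ W)
  ⊖-coverable U W = ¬¬-elim λ ¬cov →
    let
      Bad = ∃[ m ] (m ∈ U ⊖ W × ¬ Coverable (above U W m))
      next : (b : Bad) → ∃[ m ] (m ∈ above U W (proj₁ b) × ¬ Coverable (above U W m))
      next (m , _ , ¬c) = above-uncoverable U W (above U W m) proj₁ ¬c
      step : Bad → Bad
      step b = let m , (m∈ , _) , ¬c = next b in m , m∈ , ¬c
      bad : ℕ → Bad
      bad = fold (above-uncoverable U W (U ⊖ W) id ¬cov) step
    in chainFree W (λ n → proj₁ (bad n) ʳ)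
      (λ n → let _ , (m∈U , m∉W) , _ = bad n in flip-∈ W (𝓤⊆ U m∈U) m∉W)
      (λ n → let m′ , (_ , m<m′) , _ = next (bad n) in <-flip (proj₁ (bad n)) m′ m<m′)

  -- Maximal crossing families and the ultrafilters built around them.

  PairwiseCrossing : List Separation → Set (suc ℓ)
  PairwiseCrossing = AllPairs Cross

  crossing-pair : ∀ {xs} → PairwiseCrossing xs → ∀ {s t} → s ∈ₗ xs → t ∈ₗ xs → s ≈ₛ t ⊎ Cross s t
  crossing-pair (_∷_ {x} _ _) {s} {t} (here s≈x) (here t≈x) = inj₁ (≈-trans {s} {x} {t} s≈x (≈-sym {t} {x} t≈x))
  crossing-pair (_∷_ {x} x∤ _) {s} {t} (here s≈x) (there t∈) =
    inj₂ (Cross-resp {x} {s} {t} {t} (≈-sym {s} {x} s≈x) (≈-refl {t})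
      (All.lookupₛ separationSetoid {P = Cross x} (λ {u} {u′} → Cross-respʳ x {u} {u′}) x∤ {t} t∈))
  crossing-pair (_∷_ {x} x∤ _) {s} {t} (there s∈) (here t≈x) =
    inj₂ (Cross-sym {t} {s} (Cross-resp {x} {t} {s} {s} (≈-sym {t} {x} t≈x) (≈-refl {s})
      (All.lookupₛ separationSetoid {P = Cross x} (λ {u} {u′} → Cross-respʳ x {u} {u′}) x∤ {s} s∈)))
  crossing-pair (_ ∷ cross) {s} {t} (there s∈) (there t∈) = crossing-pair cross {s} {t} s∈ t∈

  Extensible : Pred Separation ℓ → Set (suc ℓ)
  Extensible P = ∀ xs → All P xs → PairwiseCrossing xs → ∃[ t ] (t ∈ P × All (Cross t) xs)

  -- Repeated extension yields growing lists whose union is pairwise crossing, hence covered by some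
  -- `ys`; but the list at stage `length ys + 1` has that many distinct entries.
  ¬extensible : (P : Pred Separation ℓ) → P ⊆ member → ¬ Extensible P
  ¬extensible P P⊆ extend = ℕₚ.<-irrefl refl (subst (ℕ._≤ List.length ys) (length-list k)
    (Unique-length-≤ (AllPairs.map (λ {s} {t} → Cross⇒≉ {s} {t}) (list-crossing k)) (λ t t∈ → cov t (k , t∈))))
    where
    State : Set (suc ℓ)
    State = ∃[ xs ] (All P xs × PairwiseCrossing xs)

    step : State → State
    step (xs , xs⊆ , cross) with t , t∈ , t-cross ← extend xs xs⊆ cross = t ∷ xs , t∈ ∷ xs⊆ , t-cross ∷ cross

    state : ℕ → State
    state = fold ([] , [] , []) step

    list : ℕ → List Separation
    list = proj₁ ∘ state

    list-crossing : ∀ n → PairwiseCrossing (list n)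
    list-crossing = proj₂ ∘ proj₂ ∘ state

    list-mono : ∀ k n t → t ∈ₗ list n → t ∈ₗ list (k ℕ.+ n)
    list-mono zero      n t t∈ = t∈
    list-mono (ℕ.suc k) n t t∈ = there (list-mono k n t t∈)

    length-list : ∀ n → List.length (list n) ≡ n
    length-list zero      = refl
    length-list (ℕ.suc n) = cong ℕ.suc (length-list n)

    Listed : Pred Separation (suc ℓ)
    Listed t = ∃[ n ] (t ∈ₗ list n)

    listed-coverable : Coverable Listed
    listed-coverable = crossing-coverable Listed
      (λ {t} (n , t∈) → All.lookupₛ separationSetoid resp (All.map P⊆ (proj₁ (proj₂ (state n)))) {t} t∈)
      (λ {s} {t} (m , s∈) (n , t∈) s≉t → Sum.[ (λ s≈t → contradiction s≈t s≉t) , id ]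
        (crossing-pair (list-crossing (n ℕ.+ m)) {s} {t} (list-mono n m s s∈)
          (subst (λ i → t ∈ₗ list i) (ℕₚ.+-comm m n) (list-mono m n t t∈))))

    ys : List Separation
    ys = proj₁ listed-coverable

    cov : ∀ t → t ∈ Listed → t ∈ₗ ys
    cov = proj₂ listed-coverable

    k : ℕ
    k = ℕ.suc (List.length ys)

  maximal-crossing : (P : Pred Separation ℓ) → P ⊆ member →
    ∃[ xs ] (All P xs × PairwiseCrossing xs × (∀ t → t ∈ P → ¬ All (Cross t) xs))
  maximal-crossing P P⊆ = ¬¬-elim λ ∄max → ¬extensible P P⊆ λ xs xs⊆ cross →
    ¬¬-elim λ ∄t → ∄max (xs , xs⊆ , cross , λ t t∈ all → ∄t (t , t∈ , all))

  -- The constructed ultrafilter has the (arbitrarily oriented) elements of xs as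
  -- minimal elements; by maximality of xs every other separation with K ⊆ A ∩ B is
  -- nested with one of them, which dictates its orientation.
  module Extension (K : List V) (one-sided : ∀ {s} → s ∈ member → All (A s) K ⊎ All (B s) K)
    (xs : List Separation)
    (xs-neutral : All (λ s → s ∈ member × All (A s) K × All (B s) K) xs)
    (xs-crossing : PairwiseCrossing xs)
    (xs-maximal : ∀ t → t ∈ member × All (A t) K × All (B t) K → ¬ All (Cross t) xs) where

    -- Weak on one side and strict on the other, so that a member `x` supports itself but not `x ʳ`.
    Supported : Separation → Pred Separation ℓ
    Supported t x = x ≤ t ⊎ x ʳ < t

    -- The second alternative does not ask for `All (B t) K`, which makes each alternative upward
    -- closed by itself.
    Chosen : Pred Separation ℓ
    Chosen t = t ∈ member × All (A t) K × (¬ All (B t) K ⊎ ⌜ Any (Supported t) xs ⌝)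

    -- Each kind of nestedness puts `t` or `t ʳ` above `x` or `x ʳ`. Where strictness over `x ʳ`
    -- fails, the opposite orientation equals `x` and is supported by it.
    nested⇒supported : ∀ t x → Nested t x → Supported t x ⊎ Supported (t ʳ) x
    nested⇒supported t x (inj₁ (inj₂ x≤t)) = inj₁ (inj₁ x≤t)
    nested⇒supported t x (inj₁ (inj₁ t≤x)) with em↓ {t ≈ₛ x}
    ... | yes t≈x = inj₁ (inj₁ (≈⇒≤ x t (≈-sym {t} {x} t≈x)))
    ... | no  t≉x = inj₂ (inj₂ (<-flip t x (t≤x , t≉x)))
    nested⇒supported t x (inj₂ (inj₁ t≤xʳ)) = inj₂ (inj₁ (swap t≤xʳ))
    nested⇒supported t x (inj₂ (inj₂ xʳ≤t)) with em↓ {x ʳ ≈ₛ t}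
    ... | yes xʳ≈t = inj₂ (inj₁ (≈⇒≤ x (t ʳ) (swap xʳ≈t)))
    ... | no  xʳ≉t = inj₁ (inj₂ (xʳ≤t , xʳ≉t))

    nested⇒chosen : ∀ {t} → t ∈ member × All (A t) K × All (B t) K →
      Any (Nested t) xs → t ∈ Chosen ⊎ t ʳ ∈ Chosen
    nested⇒chosen {t} (t∈ , K⊆A , K⊆B) any = Sum.map
      (λ sup → t∈ , K⊆A , inj₂ (⌜⌝-in sup)) (λ sup → flip t∈ , K⊆B , inj₂ (⌜⌝-in sup))
      (Anyₚ.Any-⊎⁻ (Any.map (λ {x} → nested⇒supported t x) any))

    total : ∀ t → t ∈ member → t ∈ Chosen ⊎ t ʳ ∈ Chosen
    total t t∈ with em↓ {All (A t) K} | em↓ {All (B t) K} | one-sided t∈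
    ... | no K⊈A  | _       | inj₁ K⊆A = contradiction K⊆A K⊈A
    ... | no K⊈A  | _       | inj₂ K⊆B = inj₂ (flip t∈ , K⊆B , inj₁ K⊈A)
    ... | yes K⊆A | no K⊈B  | _        = inj₁ (t∈ , K⊆A , inj₁ K⊈B)
    ... | yes K⊆A | yes K⊆B | _        = nested⇒chosen (t∈ , K⊆A , K⊆B)
      (Any.map (λ {x} → ¬¬-elim↓ {x}) (¬All⇒Any¬ (λ _ → em↓) xs (xs-maximal t (t∈ , K⊆A , K⊆B))))
      where
      ¬¬-elim↓ : ∀ {x} → ¬ Cross t x → Nested t x
      ¬¬-elim↓ = decidable-stable em↓

    -- Composing the two supports through `t` compares `x` with `y` or `y ʳ`. For `x ≈ₛ y` the
    -- result would be `x < x` or a comparison of `x` with its own flip.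
    supported-opposite : ∀ t x y → x ∈ member → Supported t x → Supported (t ʳ) y →
      (x ≈ₛ y → ⊥) × Nested x y
    supported-opposite t x y x∈ (inj₁ x≤t) (inj₁ y≤tʳ) =
      (λ x≈y → s≰sʳ x∈ (≤-trans x (y ʳ) (x ʳ) x≤yʳ (≈⇒≤ (y ʳ) (x ʳ) (swap (≈-sym {x} {y} x≈y))))) ,
      inj₂ (inj₁ x≤yʳ)
      where
      x≤yʳ : x ≤ y ʳ
      x≤yʳ = ≤-trans x t (y ʳ) x≤t (swap y≤tʳ)
    supported-opposite t x y x∈ (inj₁ x≤t) (inj₂ yʳ<tʳ) =
      proj₂ x<y , inj₁ (inj₁ (proj₁ x<y))
      where
      x<y : x < y
      x<y = ≤-<-trans x t y x≤t (<-flip (y ʳ) (t ʳ) yʳ<tʳ)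
    supported-opposite t x y x∈ (inj₂ xʳ<t) (inj₁ y≤tʳ) =
      proj₂ y<x ∘ ≈-sym {x} {y} , inj₁ (inj₂ (proj₁ y<x))
      where
      y<x : y < x
      y<x = ≤-<-trans y (t ʳ) x y≤tʳ (<-flip (x ʳ) t xʳ<t)
    supported-opposite t x y x∈ (inj₂ xʳ<t) (inj₂ yʳ<tʳ) =
      (λ x≈y → sʳ≰s x∈ (≤-trans (x ʳ) y x xʳ≤y (≈⇒≤ y x (≈-sym {x} {y} x≈y)))) ,
      inj₂ (inj₂ (swap xʳ≤y))
      where
      xʳ≤y : x ʳ ≤ y
      xʳ≤y = ≤-trans (x ʳ) t y (proj₁ xʳ<t) (swap (proj₁ yʳ<tʳ))

    consistent : ∀ t → t ∈ Chosen → t ʳ ∉ Chosen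
    consistent t (_ , K⊆A , _) (_ , K⊆B , inj₁ K⊈A) = K⊈A K⊆A
    consistent t (_ , K⊆A , inj₁ K⊈B) (_ , K⊆B , _) = K⊈B K⊆B
    consistent t (_ , K⊆A , inj₂ p) (_ , K⊆B , inj₂ q) =
      let x , x∈ , t-x = find (⌜⌝-out p)
          y , y∈ , tʳ-y = find (⌜⌝-out q)
          x≉y , nested = supported-opposite t x y (proj₁ (All.lookup xs-neutral x∈)) t-x tʳ-y
      in Sum.[ x≉y , (λ cross → cross nested) ]
           (crossing-pair xs-crossing {x} {y} (Any.map (λ { refl → ≈-refl {x} }) x∈)
             (Any.map (λ { refl → ≈-refl {y} }) y∈))

    supported-up : ∀ t u x → t ≤ u → Supported t x → Supported u x
    supported-up t u x t≤u = Sum.map (λ x≤t → ≤-trans x t u x≤t t≤u) (λ xʳ<t → <-≤-trans (x ʳ) t u xʳ<t t≤u)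

    chosen-up : ∀ t u → t ∈ Chosen → u ∈ member → t ≤ u → u ∈ Chosen
    chosen-up t u (_ , K⊆A , side) u∈ t≤u = u∈ , All.map (proj₁ t≤u) K⊆A , Sum.map
      (λ K⊈B → K⊈B ∘ All.map (proj₂ t≤u))
      (λ sup → ⌜⌝-in (Any.map (λ {x} → supported-up t u x t≤u) (⌜⌝-out sup))) side

    -- By `split`, one alternative of `Chosen` holds along the whole chain. In the first, a single
    -- `v` in `K` avoids every `B (c n)`, against `ecc`; in the second, a single `x` or `x ʳ` bounds
    -- the chain below, against discreteness.
    chosen-chainFree : ChainFree Chosen
    chosen-chainFree c c∈ desc with split em↓
      {P = λ n → ¬ All (B (c n)) K} {Q = λ n → ⌜ Any (Supported (c n)) xs ⌝}
      (λ n K⊈B → K⊈B ∘ All.map (proj₂ (proj₁ (desc n))))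
      (λ n sup → ⌜⌝-in (Any.map (λ {x} → supported-up (c (ℕ.suc n)) (c n) x (proj₁ (desc n))) (⌜⌝-out sup)))
      (proj₂ ∘ proj₂ ∘ c∈)
    ... | inj₁ K⊈B =
      let v , v∈ , v∉B = find (splitAny em↓ {P = λ v n → ¬ B (c n) v}
            (λ v n v∉B → v∉B ∘ proj₂ (proj₁ (desc n))) K
            (λ n → ¬All⇒Any¬ (λ _ → em↓) K (K⊈B n)))
      in ecc c (proj₁ ∘ c∈) desc v λ n → All.lookup (proj₁ (proj₂ (c∈ n))) v∈ , v∉B n
    ... | inj₂ sup =
      let x , x∈ , c-x = find (splitAny em↓ {P = λ x n → Supported (c n) x}
            (λ x n → supported-up (c (ℕ.suc n)) (c n) x (proj₁ (desc n))) xs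
            (λ n → ⌜⌝-out (sup n)))
          x∈member = proj₁ (All.lookup xs-neutral x∈)
      in Sum.[ (λ x≤c → chainFree-above x∈member c (λ n → proj₁ (c∈ n) , x≤c n) desc)
             , (λ xʳ<c → chainFree-above (flip x∈member) c (λ n → proj₁ (c∈ n) , proj₁ (xʳ<c n)) desc) ]
           (split em↓ {P = λ n → x ≤ c n} {Q = λ n → x ʳ < c n}
             (λ n x≤c → ≤-trans x (c (ℕ.suc n)) (c n) x≤c (proj₁ (desc n)))
             (λ n xʳ<c → <-≤-trans (x ʳ) (c (ℕ.suc n)) (c n) xʳ<c (proj₁ (desc n))) c-x)

    extension : DCCUltrafilter
    extension = ultrafilter Chosen proj₁ total consistent chosen-up chosen-chainFree

  extending : (K : List V) → (∀ {s} → s ∈ member → All (A s) K ⊎ All (B s) K) →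
    ∃[ U ] (∀ s → s ∈ 𝓤 U → All (A s) K)
  extending K one-sided =
    let xs , neutral , crossing , maximal =
          maximal-crossing (λ s → s ∈ member × All (A s) K × All (B s) K) proj₁
    in Extension.extension K one-sided xs neutral crossing maximal , λ _ → proj₁ ∘ proj₂

  -- Flipping a minimal element of an ultrafilter.

  module Flip (U : DCCUltrafilter) (s : Separation) (s∈ : s ∈ 𝓤 U)
    (s-min : ∀ t → t ∈ 𝓤 U → ¬ t < s) where

    Flipped : Pred Separation ℓ
    Flipped t = (t ∈ 𝓤 U × ¬ t ≈ₛ s) ⊎ t ≈ₛ s ʳ

    s∈member : s ∈ member
    s∈member = 𝓤⊆ U s∈

    s≉sʳ : ¬ s ≈ₛ s ʳ
    s≉sʳ e = s≰sʳ s∈member (≈⇒≤ s (s ʳ) e)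

    total : ∀ t → t ∈ member → t ∈ Flipped ⊎ t ʳ ∈ Flipped
    total t t∈ with em↓ {t ≈ₛ s} | em↓ {t ≈ₛ s ʳ} | choose U t∈
    ... | yes t≈s | _        | _               = inj₂ (inj₂ (swap t≈s))
    ... | no _    | yes t≈sʳ | _               = inj₁ (inj₂ t≈sʳ)
    ... | no t≉s  | no _     | inj₁ (t∈U , _)  = inj₁ (inj₁ (t∈U , t≉s))
    ... | no _    | no t≉sʳ  | inj₂ (_ , tʳ∈U) = inj₂ (inj₁ (tʳ∈U , t≉sʳ ∘ swap))

    consistent : ∀ t → t ∈ Flipped → t ʳ ∉ Flipped
    consistent t (inj₁ (t∈ , _))  (inj₁ (tʳ∈ , _)) = excl U t∈ tʳ∈
    consistent t (inj₁ (_ , t≉s)) (inj₂ tʳ≈sʳ)     = t≉s (swap tʳ≈sʳ)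
    consistent t (inj₂ t≈sʳ) (inj₁ (_ , tʳ≉s))     = tʳ≉s (swap t≈sʳ)
    consistent t (inj₂ t≈sʳ) (inj₂ tʳ≈sʳ)          =
      s≉sʳ (≈-trans {s} {t} {s ʳ} (≈-sym {t} {s} (swap tʳ≈sʳ)) t≈sʳ)

    -- Minimality of `s` is used twice: nothing in `U` other than `s` lies below `s`, and if `u`
    -- above `s ʳ` were neither `s ʳ` nor in `U`, then `u ʳ` would be in `U` strictly below `s`.
    flipped-up : ∀ t u → t ∈ Flipped → u ∈ member → t ≤ u → u ∈ Flipped
    flipped-up t u (inj₁ (t∈ , t≉s)) u∈ t≤u = inj₁ (up U {t} {u} t∈ u∈ t≤u , λ u≈s →
      s-min t t∈ (≤-trans t u s t≤u (≈⇒≤ u s u≈s) , t≉s))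
    flipped-up t u (inj₂ t≈sʳ) u∈ t≤u with em↓ {u ≈ₛ s ʳ} | em↓ {u ∈ 𝓤 U}
    ... | yes u≈sʳ | _ = inj₂ u≈sʳ
    ... | no u≉sʳ | yes u∈U = inj₁ (u∈U , λ u≈s → sʳ≰s s∈member
      (≤-trans (s ʳ) u s (≤-trans (s ʳ) t u (≈⇒≤ (s ʳ) t (≈-sym {t} {s ʳ} t≈sʳ)) t≤u) (≈⇒≤ u s u≈s)))
    ... | no u≉sʳ | no u∉U = contradiction
      (swap (≤-trans (s ʳ) t u (≈⇒≤ (s ʳ) t (≈-sym {t} {s ʳ} t≈sʳ)) t≤u) , λ uʳ≈s → u≉sʳ (swap uʳ≈s))
      (s-min (u ʳ) (flip-∈ U u∈ u∉U))

    flipped⊆ : Flipped ⊆ member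
    flipped⊆ (inj₁ (t∈ , _)) = 𝓤⊆ U t∈
    flipped⊆ {t} (inj₂ t≈sʳ) = resp (≈-sym {t} {s ʳ} t≈sʳ) (flip s∈member)

    -- `c n ≈ₛ s ʳ` is not antitone in `n`; it is weakened to `s ʳ ≤ c n`, which is, and which
    -- discreteness still excludes along a whole chain.
    flipped-chainFree : ChainFree Flipped
    flipped-chainFree c c∈ desc with split em↓ {P = λ n → c n ∈ 𝓤 U} {Q = λ n → s ʳ ≤ c n}
      (λ n t∈ → up U {c (ℕ.suc n)} {c n} t∈ (flipped⊆ (c∈ n)) (proj₁ (desc n)))
      (λ n sʳ≤ → ≤-trans (s ʳ) (c (ℕ.suc n)) (c n) sʳ≤ (proj₁ (desc n)))
      (λ n → Sum.map proj₁ (λ t≈sʳ → ≈⇒≤ (s ʳ) (c n) (≈-sym {c n} {s ʳ} t≈sʳ)) (c∈ n))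
    ... | inj₁ c∈U  = chainFree U c c∈U desc
    ... | inj₂ sʳ≤c = chainFree-above (flip s∈member) c (λ n → flipped⊆ (c∈ n) , sʳ≤c n) desc

    flipped : DCCUltrafilter
    flipped = ultrafilter Flipped flipped⊆ total consistent flipped-up flipped-chainFree

    s∉flipped : s ∉ Flipped
    s∉flipped (inj₁ (_ , s≉s)) = s≉s (≈-refl {s})
    s∉flipped (inj₂ s≈sʳ)      = s≉sʳ s≈sʳ

    flipped-adjacent : Graph.Adj (dualMedianGraph G 𝓢) U flipped
    flipped-adjacent = s ∷ s ʳ ∷ [] , (s≉sʳ ∷ []) ∷ [] ∷ [] , refl , λ t → mk⇔ (to t) (from t)
      where
      to : ∀ t → t ∈ (U ⊖ flipped) ∪ (flipped ⊖ U) → t ∈ₗ s ∷ s ʳ ∷ []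
      to t (inj₁ (t∈U , t∉)) = here (decidable-stable em↓ λ t≉s → t∉ (inj₁ (t∈U , t≉s)))
      to t (inj₂ (inj₁ (t∈U , _) , t∉U)) = contradiction t∈U t∉U
      to t (inj₂ (inj₂ t≈sʳ , _))        = there (here t≈sʳ)
      from : ∀ t → t ∈ₗ s ∷ s ʳ ∷ [] → t ∈ (U ⊖ flipped) ∪ (flipped ⊖ U)
      from t (here t≈s) = inj₁ (𝓤-resp U {s} {t} (≈-sym {t} {s} t≈s) s∈ , s∉flipped ∘ 𝓤-resp flipped {t} {s} t≈s)
      from t (there (here t≈sʳ)) = inj₂ (inj₂ t≈sʳ , excl U s∈ ∘ 𝓤-resp U {t} {s ʳ} t≈sʳ)

  -- Walks, geodesics and intervals in the dual graph.

  M : Graph (suc ℓ)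
  M = dualMedianGraph G 𝓢

  open GraphNotions M
  open Membership (Graph.vertexSetoid M) using () renaming (_∈_ to _∈ᵤ_)
  open UniqueSetoid (Graph.vertexSetoid M) using () renaming (Unique to Uniqueᵤ)

  ⊖-resp : ∀ U W s t → s ≈ₛ t → s ∈ U ⊖ W → t ∈ U ⊖ W
  ⊖-resp U W s t s≈t (s∈U , s∉W) = 𝓤-resp U {s} {t} s≈t s∈U , s∉W ∘ 𝓤-resp W {t} {s} (≈-sym {s} {t} s≈t)

  Between : DCCUltrafilter → DCCUltrafilter → Pred DCCUltrafilter (suc ℓ)
  Between U W X = ∀ s → s ∈ 𝓤 U → s ∈ 𝓤 W → s ∈ 𝓤 X

  -- An element of `X` missing from `U` would have its flip in `U`, hence in `X` as well.
  ⊆⇒≈ : ∀ U X → (∀ s → s ∈ 𝓤 U → s ∈ 𝓤 X) → Graph._≈_ M U X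
  ⊆⇒≈ U X U⊆X = (λ {s} → U⊆X s) , λ {s} s∈X → decidable-stable em↓ λ s∉U →
    excl X s∈X (U⊆X (s ʳ) (flip-∈ U (𝓤⊆ X s∈X) s∉U))

  -- Distinct `s` and `t` together with `s ʳ`, which lies in `W ⊖ U`, would be three elements of a
  -- symmetric difference of size two.
  adjacent-⊖ : ∀ U W → Graph.Adj M U W → ∀ s t → s ∈ U ⊖ W → t ∈ U ⊖ W → s ≈ₛ t
  adjacent-⊖ U W (xs , _ , length≡2 , mem) s t s∈@(s∈U , s∉W) t∈@(t∈U , t∉W) =
    decidable-stable em↓ λ s≉t → ℕₚ.<-irrefl refl
      (subst (3 ℕ.≤_) length≡2 (Unique-length-≤ (distinct s≉t) listed))
    where
    sʳ∈W : s ʳ ∈ 𝓤 W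
    sʳ∈W = flip-∈ W (𝓤⊆ U s∈U) s∉W

    distinct : ¬ s ≈ₛ t → Unique (s ∷ t ∷ s ʳ ∷ [])
    distinct s≉t = (s≉t ∷ (λ e → excl U s∈U (𝓤-resp U {s} {s ʳ} e s∈U)) ∷ [])
      ∷ ((λ e → excl U s∈U (𝓤-resp U {t} {s ʳ} e t∈U)) ∷ []) ∷ [] ∷ []

    listed : ∀ x → x ∈ₗ s ∷ t ∷ s ʳ ∷ [] → x ∈ₗ xs
    listed x (here x≈s) = Equivalence.to (mem x)
      (inj₁ (𝓤-resp U {s} {x} (≈-sym {x} {s} x≈s) s∈U , s∉W ∘ 𝓤-resp W {x} {s} x≈s))
    listed x (there (here x≈t)) = Equivalence.to (mem x)
      (inj₁ (𝓤-resp U {t} {x} (≈-sym {x} {t} x≈t) t∈U , t∉W ∘ 𝓤-resp W {x} {t} x≈t))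
    listed x (there (there (here x≈sʳ))) = Equivalence.to (mem x)
      (inj₂ (𝓤-resp W {s ʳ} {x} (≈-sym {x} {s ʳ} x≈sʳ) sʳ∈W , excl U s∈U ∘ 𝓤-resp U {x} {s ʳ} x≈sʳ))

  edge-separation : ∀ U W → Graph.Adj M U W → ∃[ c ] (∀ s → s ∈ U ⊖ W → s ≈ₛ c)
  edge-separation U W UW with em {∃[ c ] (c ∈ U ⊖ W)}
  edge-separation U W UW | yes (c , c∈) = c , λ s s∈ → adjacent-⊖ U W UW s c s∈ c∈
  -- With `U ⊖ W` empty any separation will do; the list of the symmetric difference supplies one.
  edge-separation U W (c ∷ _ , _) | no ∄ = c , λ s s∈ → contradiction (s , s∈) ∄

  -- One separation is recorded per edge, and an `s` missing at a visited `X` was lost along some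
  -- edge before it. Taking `X` to be the end bounds the length of the walk; an inner `X` detects
  -- separations lost and regained.
  walk-separations : ∀ {U W} (w : Walk U W) → ∃[ cs ] (List.length cs ≡ walkLength w ×
    (∀ s X → s ∈ 𝓤 U → X ∈ᵤ vertices w → s ∉ 𝓤 X → s ∈ₗ cs))
  walk-separations [ _ ] = [] , refl , λ { s X s∈U (here X≈U) s∉X → contradiction (proj₂ X≈U s∈U) s∉X }
  walk-separations {U} (_∷_ {v = U′} UU′ w) =
    let c , c-only       = edge-separation U U′ UU′
        cs , len , cross = walk-separations w
    in c ∷ cs , cong ℕ.suc len , λ
      { s X s∈U (here X≈U) s∉X → contradiction (proj₂ X≈U s∈U) s∉X
      ; s X s∈U (there X∈) s∉X → Sum.[ (λ s∈U′ → there (cross s X s∈U′ X∈ s∉X))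
                                    , (λ s∉U′ → here (c-only s (s∈U , s∉U′))) ]′
          (toSum em↓)
      }

  end∈vertices : ∀ {U W} (w : Walk U W) → W ∈ᵤ vertices w
  end∈vertices [ U≈W ] = here (swap U≈W)
  end∈vertices (_ ∷ w) = there (end∈vertices w)

  start∈vertices : ∀ {U W} X (w : Walk U W) → Graph._≈_ M X U → X ∈ᵤ vertices w
  start∈vertices X [ _ ]   X≈U = here X≈U
  start∈vertices X (_ ∷ _) X≈U = here X≈U

  -- `seps` certifies minimal length: every walk from `U` to `W` has to lose all its entries, and
  -- this one has no more edges than that. `X` is a vertex to be visited on the way.
  record Straight (U W X : DCCUltrafilter) : Set (suc ℓ) where
    field
      walk     : Walk U W
      unique   : Uniqueᵤ (vertices walk)
      through  : X ∈ᵤ vertices walk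
      between  : All (Between U W) (vertices walk)
      seps     : List Separation
      seps-⊖   : All (U ⊖ W) seps
      seps-unique : Unique seps
      seps-length : List.length seps ≡ walkLength walk

    path : Path U W
    path = walk , unique

  open Straight

  -- All later vertices are between the flipped ultrafilter and `W`, so they contain `s ʳ`. Hence
  -- `U` does not recur, and `s`, absent from the flipped ultrafilter, is new among the `seps`.
  straight-∷ : ∀ U W X s (s∈ : s ∈ 𝓤 U) (s-min : ∀ t → t ∈ 𝓤 U → ¬ t < s) → s ∉ 𝓤 W →
    Straight (Flip.flipped U s s∈ s-min) W X → Straight U W X
  straight-∷ U W X s s∈ s-min s∉W σ = record
    { walk        = flipped-adjacent ∷ walk σ
    ; unique      = All.map (λ {Y} → U≉ {Y}) (between σ) ∷ unique σ
    ; through     = there (through σ)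
    ; between     = (λ t t∈U _ → t∈U) ∷ All.map (λ {Y} → widen {Y}) (between σ)
    ; seps        = s ∷ seps σ
    ; seps-⊖      = (s∈ , s∉W) ∷ All.map (λ {t} → keep t) (seps-⊖ σ)
    ; seps-unique = All.map (λ {t} (t∈ , _) s≈t →
        s∉flipped (𝓤-resp flipped {t} {s} (≈-sym {s} {t} s≈t) t∈)) (seps-⊖ σ) ∷ seps-unique σ
    ; seps-length = cong ℕ.suc (seps-length σ)
    }
    where
    open Flip U s s∈ s-min

    sʳ∈W : s ʳ ∈ 𝓤 W
    sʳ∈W = flip-∈ W s∈member s∉W

    U≉ : ∀ {Y} → Between flipped W Y → ¬ Graph._≈_ M U Y
    U≉ btw U≈Y = excl U s∈ (proj₂ U≈Y (btw (s ʳ) (inj₂ (≈-refl {s ʳ})) sʳ∈W))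

    widen : ∀ {Y} → Between flipped W Y → Between U W Y
    widen btw t t∈U t∈W = btw t (inj₁ (t∈U , λ t≈s → s∉W (𝓤-resp W {t} {s} t≈s t∈W))) t∈W

    keep : ∀ t → t ∈ flipped ⊖ W → t ∈ U ⊖ W
    keep t (inj₁ (t∈U , _) , t∉W) = t∈U , t∉W
    keep t (inj₂ t≈sʳ , t∉W) = contradiction (𝓤-resp W {s ʳ} {t} (≈-sym {t} {s ʳ} t≈sʳ) sʳ∈W) t∉W

  -- The list xs bounds what remains to be flipped on the way to Y.
  straight-towards : ∀ W X Y → (∀ U → Graph._≈_ M U Y → Straight U W X) →
    ∀ n U xs → List.length xs ℕ.≤ n → (∀ s → s ∈ U ⊖ Y → s ∈ₗ xs) → Between U W Y → Straight U W X
  straight-towards W X Y arrived n U xs xs≤n cov btw = go (em {∃[ s ] (s ∈ U ⊖ Y)}) n xs≤n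
    where
    advance : ∀ s (s∈ : s ∈ U ⊖ Y) (s-min : ∀ t → t ∈ 𝓤 U → ¬ t < s) n → List.length xs ℕ.≤ n → Straight U W X
    advance s s∈ s-min zero xs≤0 = contradiction (ℕₚ.≤-trans (length-remove s xs (cov s s∈)) xs≤0) λ ()
    advance s (s∈U , s∉Y) s-min (ℕ.suc n) xs≤n =
      straight-∷ U W X s s∈U s-min (λ s∈W → s∉Y (btw s s∈U s∈W))
        (straight-towards W X Y arrived n flipped (remove s xs)
          (ℕₚ.≤-pred (ℕₚ.≤-trans (length-remove s xs (cov s (s∈U , s∉Y))) xs≤n)) cov′ btw′)
      where
      open Flip U s s∈U s-min

      sʳ∈Y : s ʳ ∈ 𝓤 Y
      sʳ∈Y = flip-∈ Y s∈member s∉Y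

      cov′ : ∀ t → t ∈ flipped ⊖ Y → t ∈ₗ remove s xs
      cov′ t (inj₁ (t∈U , t≉s) , t∉Y) = ∈-remove s t xs (cov t (t∈U , t∉Y)) (t≉s ∘ ≈-sym {s} {t})
      cov′ t (inj₂ t≈sʳ , t∉Y) = contradiction (𝓤-resp Y {s ʳ} {t} (≈-sym {t} {s ʳ} t≈sʳ) sʳ∈Y) t∉Y

      btw′ : Between flipped W Y
      btw′ t (inj₁ (t∈U , _)) t∈W = btw t t∈U t∈W
      btw′ t (inj₂ t≈sʳ) _ = 𝓤-resp Y {s ʳ} {t} (≈-sym {t} {s ʳ} t≈sʳ) sʳ∈Y

    go : Dec (∃[ s ] (s ∈ U ⊖ Y)) → ∀ n → List.length xs ℕ.≤ n → Straight U W X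
    go (no ∄s) _ _ = arrived U (⊆⇒≈ U Y λ s s∈U → decidable-stable em↓ λ s∉Y → ∄s (s , s∈U , s∉Y))
    go (yes (s₀ , s₀∈)) n xs≤n =
      let s , s∈@(s∈U , s∉Y) , s-min = minimal (U ⊖ Y) (⊖-chainFree U Y) s₀∈
      -- An element minimal in `U ⊖ Y` is minimal in `U`: anything of `U` below it that lay in `Y`
      -- would force it into `Y`.
      in advance s s∈ (λ t t∈U t<s → s-min t
           (t∈U , λ t∈Y → s∉Y (up Y {t} {s} t∈Y (𝓤⊆ U s∈U) (proj₁ t<s))) t<s) n xs≤n

  -- The walk heads for `X` and then for `W`; as `X` is between, the first leg too flips only
  -- separations outside `W`. The second leg is built as a walk visiting its end, and `via-start`
  -- then marks its first vertex `X` instead.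
  straight-via : ∀ U W X → Between U W X → Straight U W X
  straight-via U W X btw =
    towards X (λ U′ U′≈X → via-start U′ U′≈X (towards W arrived U′ (λ _ _ t∈W → t∈W))) U btw
    where
    towards : ∀ {X} Y → (∀ U → Graph._≈_ M U Y → Straight U W X) → ∀ U → Between U W Y → Straight U W X
    towards {X} Y arrived U = straight-towards W X Y arrived _ U
      (proj₁ (⊖-coverable U Y)) ℕₚ.≤-refl (proj₂ (⊖-coverable U Y))

    arrived : ∀ U → Graph._≈_ M U W → Straight U W W
    arrived U U≈W = record
      { walk = [ U≈W ] ; unique = [] ∷ [] ; through = here (swap U≈W) ; between = (λ t t∈U _ → t∈U) ∷ []
      ; seps = [] ; seps-⊖ = [] ; seps-unique = [] ; seps-length = refl }

    via-start : ∀ U → Graph._≈_ M U X → Straight U W W → Straight U W X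
    via-start U U≈X σ = record
      { walk = walk σ ; unique = unique σ ; through = start∈vertices X (walk σ) (swap U≈X) ; between = between σ
      ; seps = seps σ ; seps-⊖ = seps-⊖ σ ; seps-unique = seps-unique σ ; seps-length = seps-length σ }

  straight-geodesic : ∀ {U W X} (σ : Straight U W X) → IsGeodesic (path σ)
  straight-geodesic {U} {W} σ (w , _) =
    let cs , len , cross = walk-separations w
    in subst (ℕ._≤ walkLength w) (seps-length σ) (subst (List.length (seps σ) ℕ.≤_) len
      (Unique-length-≤ (seps-unique σ) λ s s∈ →
        let s∈U , s∉W = All.lookupₛ separationSetoid {P = U ⊖ W} (λ {t} {u} → ⊖-resp U W t u) (seps-⊖ σ) {s} s∈
        in cross s W s∈U (end∈vertices w) s∉W))

  -- If `s` were lost at `X`, the separations recorded along the geodesic would include `s` besides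
  -- all the `seps` of a straight walk, making the geodesic longer than that walk.
  geodesic⇒between : ∀ {U W} (P : Path U W) → IsGeodesic P → ∀ X → X ∈ᵤ pathVertices P → Between U W X
  geodesic⇒between {U} {W} (w , uniq) geo X X∈ s s∈U s∈W = decidable-stable em↓ λ s∉X →
    let
      σ = straight-via U W U (λ _ t∈U _ → t∈U)
      cs , len , cross = walk-separations w
      all⊖ : ∀ t → t ∈ₗ seps σ → t ∈ U ⊖ W
      all⊖ t t∈ = All.lookupₛ separationSetoid {P = U ⊖ W} (λ {t} {u} → ⊖-resp U W t u) (seps-⊖ σ) {t} t∈
      listed : ∀ t → t ∈ₗ s ∷ seps σ → t ∈ₗ cs
      listed = λ
        { t (here t≈s) → Any.map (λ {c} s≈c → ≈-trans {t} {s} {c} t≈s s≈c) (cross s X s∈U X∈ s∉X)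
        ; t (there t∈) → cross t W (proj₁ (all⊖ t t∈)) (end∈vertices w) (proj₂ (all⊖ t t∈)) }
      longer : ℕ.suc (List.length (seps σ)) ℕ.≤ List.length cs
      longer = Unique-length-≤
        (All.map (λ {t} (_ , t∉W) s≈t → t∉W (𝓤-resp W {s} {t} s≈t s∈W)) (seps-⊖ σ) ∷ seps-unique σ)
        listed
    in ℕₚ.<-irrefl refl (ℕₚ.≤-trans (subst (λ n → ℕ.suc n ℕ.≤ List.length cs) (seps-length σ) longer)
         (subst (ℕ._≤ walkLength (walk σ)) (sym len) (geo (path σ))))

  between⇒I : ∀ U W X → Between U W X → X ∈ I U W
  between⇒I U W X btw = let σ = straight-via U W X btw in path σ , straight-geodesic σ , through σ

  I⇒between : ∀ U W X → X ∈ I U W → Between U W X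
  I⇒between U W X (P , geo , X∈) = geodesic⇒between P geo X X∈

  -- Medians as majority votes.

  Majority : DCCUltrafilter → DCCUltrafilter → DCCUltrafilter → Pred Separation ℓ
  Majority U W X s = (s ∈ 𝓤 U × s ∈ 𝓤 W) ⊎ (s ∈ 𝓤 W × s ∈ 𝓤 X) ⊎ (s ∈ 𝓤 X × s ∈ 𝓤 U)

  majority : DCCUltrafilter → DCCUltrafilter → DCCUltrafilter → DCCUltrafilter
  majority U W X = ultrafilter (Majority U W X) majority⊆ total consistent majority-up majority-chainFree
    where
    majority⊆ : Majority U W X ⊆ member
    majority⊆ = Sum.[ 𝓤⊆ U ∘ proj₁ , Sum.[ 𝓤⊆ W ∘ proj₁ , 𝓤⊆ X ∘ proj₁ ] ]

    total : ∀ s → s ∈ member → s ∈ Majority U W X ⊎ s ʳ ∈ Majority U W X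
    total s s∈ with choose U s∈ | choose W s∈ | choose X s∈
    ... | inj₁ (u , _) | inj₁ (w , _) | _ = inj₁ (inj₁ (u , w))
    ... | inj₁ (u , _) | inj₂ _ | inj₁ (x , _) = inj₁ (inj₂ (inj₂ (x , u)))
    ... | inj₁ _ | inj₂ (_ , w) | inj₂ (_ , x) = inj₂ (inj₂ (inj₁ (w , x)))
    ... | inj₂ _ | inj₁ (w , _) | inj₁ (x , _) = inj₁ (inj₂ (inj₁ (w , x)))
    ... | inj₂ (_ , u) | inj₁ _ | inj₂ (_ , x) = inj₂ (inj₂ (inj₂ (x , u)))
    ... | inj₂ (_ , u) | inj₂ (_ , w) | _ = inj₂ (inj₁ (u , w))

    -- Two majorities among three share a voter, which cannot contain both `s` and `s ʳ`.
    consistent : ∀ s → s ∈ Majority U W X → s ʳ ∉ Majority U W X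
    consistent s (inj₁ (u , w))        (inj₁ (u′ , _))        = excl U u u′
    consistent s (inj₁ (u , w))        (inj₂ (inj₁ (w′ , _))) = excl W w w′
    consistent s (inj₁ (u , w))        (inj₂ (inj₂ (_ , u′))) = excl U u u′
    consistent s (inj₂ (inj₁ (w , x))) (inj₁ (_ , w′))        = excl W w w′
    consistent s (inj₂ (inj₁ (w , x))) (inj₂ (inj₁ (w′ , _))) = excl W w w′
    consistent s (inj₂ (inj₁ (w , x))) (inj₂ (inj₂ (x′ , _))) = excl X x x′
    consistent s (inj₂ (inj₂ (x , u))) (inj₁ (u′ , _))        = excl U u u′
    consistent s (inj₂ (inj₂ (x , u))) (inj₂ (inj₁ (_ , x′))) = excl X x x′
    consistent s (inj₂ (inj₂ (x , u))) (inj₂ (inj₂ (x′ , _))) = excl X x x′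

    majority-up : ∀ s t → s ∈ Majority U W X → t ∈ member → s ≤ t → t ∈ Majority U W X
    majority-up s t s∈ t∈ s≤t = Sum.map (both U W) (Sum.map (both W X) (both X U)) s∈
      where
      both : ∀ Y Z → s ∈ 𝓤 Y × s ∈ 𝓤 Z → t ∈ 𝓤 Y × t ∈ 𝓤 Z
      both Y Z (y , z) = up Y {s} {t} y t∈ s≤t , up Z {s} {t} z t∈ s≤t

    -- Two voters out of three always include `U` or `W`, so `split` places the whole chain in one
    -- of these.
    majority-chainFree : ChainFree (Majority U W X)
    majority-chainFree c c∈ desc = Sum.[ (λ u → chainFree U c u desc) , (λ w → chainFree W c w desc) ]
      (split em↓ (down U) (down W) λ n → Sum.[ inj₁ ∘ proj₁ , Sum.[ inj₂ ∘ proj₁ , inj₁ ∘ proj₂ ] ] (c∈ n))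
      where
      down : ∀ Y n → c (ℕ.suc n) ∈ 𝓤 Y → c n ∈ 𝓤 Y
      down Y n y = up Y {c (ℕ.suc n)} {c n} y (majority⊆ (c∈ n)) (proj₁ (desc n))

  isMedian : IsMedian
  -- The empty `K` imposes no condition; it only serves to exhibit a vertex.
  isMedian = (proj₁ (extending [] (λ _ → inj₁ [])) , λ U W → path (straight-via U W U λ _ t∈U _ → t∈U)) ,
    λ U W X →
    majority U W X ,
    ( between⇒I U W (majority U W X) (λ _ u w → inj₁ (u , w))
    , between⇒I W X (majority U W X) (λ _ w x → inj₂ (inj₁ (w , x)))
    , between⇒I X U (majority U W X) (λ _ x u → inj₂ (inj₂ (x , u))) ) ,
    -- A vertex in all three intervals contains each pairwise intersection, hence the majority, and
    -- inclusion of ultrafilters is equality.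
    λ {Y} (UW , WX , XU) → ⊆⇒≈ (majority U W X) Y λ
      { s (inj₁ (u , w))        → I⇒between U W Y UW s u w
      ; s (inj₂ (inj₁ (w , x))) → I⇒between W X Y WX s w x
      ; s (inj₂ (inj₂ (x , u))) → I⇒between X U Y XU s x u
      }

  -- The axioms of a median decomposition.

  edge-one-sided : ∀ {x y} → Adj x y → ∀ {s} → s ∈ member → All (A s) (x ∷ y ∷ []) ⊎ All (B s) (x ∷ y ∷ [])
  edge-one-sided {x} {y} xy {s} s∈ with em↓ {A s x} | em↓ {B s x} | em↓ {A s y} | em↓ {B s y}
  ... | yes ax | _      | yes ay | _      = inj₁ (ax ∷ ay ∷ [])
  ... | _      | yes bx | _      | yes by = inj₂ (bx ∷ by ∷ [])
  -- Here and in the next case the edge would join the two strict sides of `s`.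
  ... | yes ax | no ¬bx | no ¬ay | yes by = contradiction xy (noEdge s (ax , ¬bx) (by , ¬ay))
  ... | no ¬ax | yes bx | yes ay | no ¬by = contradiction (Graph.adj-sym G xy) (noEdge s (ay , ¬by) (bx , ¬ax))
  ... | no ¬ax | no ¬bx | _      | _      = contradiction (cover s x) Sum.[ ¬ax , ¬bx ]
  ... | _      | _      | no ¬ay | no ¬by = contradiction (cover s y) Sum.[ ¬ay , ¬by ]

  isMedianDecomposition : IsMedianDecomposition G M (β G 𝓢)
  isMedianDecomposition = record
    { β-cong = λ (U⊆W , W⊆U) → (λ v∈ s s∈W → v∈ s (W⊆U s∈W)) , (λ v∈ s s∈U → v∈ s (U⊆W s∈U))
    ; β-resp = λ U x≈y x∈ s s∈U → A-resp s x≈y (x∈ s s∈U)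
    ; median = isMedian
    ; M1     = λ v → let U , v∈ = extending (v ∷ []) (λ {s} _ → Sum.map (_∷ []) (_∷ []) (cover s v))
                     in U , λ s s∈U → All.head (v∈ s s∈U)
    ; M2     = λ xy → let U , xy∈ = extending _ (edge-one-sided xy)
                      in U , (λ s s∈U → All.head (xy∈ s s∈U)) , (λ s s∈U → All.head (All.tail (xy∈ s s∈U)))
    -- If `s` in `X` had `v` outside `A s`, neither `U` nor `W` could contain `s`; both would
    -- contain `s ʳ`, and so would `X` between them.
    ; M3     = λ v {U} {W} v∈U v∈W P geo → All.tabulateₛ (Graph.vertexSetoid M) λ {X} X∈ s s∈X →
        decidable-stable em↓ λ v∉A →
          excl X s∈X (geodesic⇒between P geo X X∈ (s ʳ)
            (flip-∈ U (𝓤⊆ X s∈X) (λ s∈U → v∉A (v∈U s s∈U)))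
            (flip-∈ W (𝓤⊆ X s∈X) (λ s∈W → v∉A (v∈W s s∈W))))
    }

theorem6p3 : ∀ {ℓ : Level} → ExcludedMiddle (suc ℓ) →
    (G : Graph ℓ) (𝓢 : SeparationSystem G) →
    Discrete G 𝓢 → CrossingFinite G 𝓢 → ECC G 𝓢 →
    IsMedianDecomposition G (dualMedianGraph G 𝓢) (β G 𝓢)
theorem6p3 em G 𝓢 discrete crossingFinite ecc =
  Dual.isMedianDecomposition em G 𝓢 discrete crossingFinite ecc
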